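{- For every integer $a\ge1$, $\phi(p_{a,0})=(t-1)^a-(-1)^a$.
   Context: $p_{a,b}=\sum_{i\in\mathbb{Z}}x_i^ax_{ -i}^b$ in commuting variables $x_i$, $i\in\mathbb{Z}$. A signed graph is a finite graph (loops and multiple edges allowed) with $\mathrm{sgn}:E\to\{+,-\}$; a coloring $\kappa:V\to\mathbb{Z}$ is proper if $\kappa(u)\ne\mathrm{sgn}(e)\kappa(v)$ for every edge $e$ with endpoints $u,v$. An orientation assigns to each half-edge (a loop has two) an arrow toward or away from the vertex, such that on a positive edge exactly one of the two arrows points toward its vertex and on a negative edge both point toward or both point away. A cycle is a closed walk in which, considering only the edges of the walk, every vertex of the walk has at least one arrow pointing into it and one pointing out of it; an orientation is acyclic if it has no cycle; a sink is a vertex all of whose incident arrows point toward it (an isolated vertex is a sink). A signed poset is an acyclic orientation $P$ of a signed graph. A proper coloring $\kappa$ preserves $P$ if for every edge $e$ and each endpoint $v$ of $e$, with $u$ the other endpoint ($u=v$ for a loop), the arrow of $P$ at the incidence of $e$ with $v$ points toward $v$ iff $\kappa(v)>\mathrm{sgn}(e)\kappa(u)$. $Y_P=\sum_\kappa\prod_v x_{\kappa(v)}$ over proper colorings preserving $P$; $\mathbb{Y}$ is the $\mathbb{Q}$-span of all $Y_P$ (it is closed under products and contains $p_{a,b}$ for $a\ge1,b\ge0$ and $x_0$). $\phi:\mathbb{Y}\to\mathbb{Q}[t]$ is the (unique) $\mathbb{Q}$-linear map with $\phi(Y_P)=t^{\mathrm{sink}(P)}$, $\mathrm{sink}(P)$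 the number of sinks of $P$ (its existence is established in the paper). -}

module Defs where

open import Algebra.Bundles.Raw using (RawRing)
import Algebra.Definitions.RawSemiring
open import Algebra.Module.Bundles.Raw using (RawLeftModule)
import Algebra.Module.Morphism.Structures as Morphism
open import Data.Fin.Base using (Fin; opposite)
open import Data.Fin.Patterns using (0F; 1F)
import Data.Fin.Properties as Fin
open import Data.Integer.Base as ℤ using (ℤ; +_)
import Data.Integer.Properties as ℤ
open import Data.List.Base using (List; []; _∷_; _++_; map; length; filter; replicate; allFin; deduplicate; cartesianProductWith)
open import Data.List.Membership.DecPropositional ℤ._≟_ using (_∈?_)
open import Data.List.Membership.Propositional using (_∈_)
open import Data.List.Membership.Propositional.Properties using (∈-∃++)
open import Data.List.Relation.Binary.Permutation.Propositional using (_↭_; prep; ↭-refl; ↭-sym; ↭-trans)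
open import Data.List.Relation.Binary.Permutation.Propositional.Properties using (∈-resp-↭; drop-∷; shift; ¬x∷xs↭[])
open import Data.List.Relation.Unary.All using (All)
open import Data.List.Relation.Unary.Any using (here)
open import Data.Nat.Base using (ℕ; zero; suc; NonZero)
open import Data.Product.Base using (Σ; _×_; _,_; proj₁; ∃-syntax)
open import Data.Rational as ℚ using (ℚ; 0ℚ; 1ℚ; _/_)
import Data.Rational.Properties as ℚ
open import Data.Sign.Base as Sign using (Sign)
open import Data.Vec.Base using (Vec; []; _∷_; lookup; toList)
open import Function.Bundles using (_⇔_; mk⇔; Equivalence)
open import Level using (0ℓ)
open import Relation.Binary.Construct.Closure.ReflexiveTransitive using (Star; ε; _◅_)
open import Relation.Binary.PropositionalEquality
open import Relation.Nullary using (Dec; yes; no; ¬_; ¬?; map′; _×-dec_; _→-dec_)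

_⊙_ : Sign → ℤ → ℤ
Sign.+ ⊙ i = i
Sign.- ⊙ i = ℤ.- i

-- The half-edges are the pairs (e , h) with h : Fin 2, and opposite exchanges
-- the two ends of an edge; a loop has the same endpoint at both ends.
record SignedGraph : Set where
  field
    #V #E    : ℕ
    endpoint : Fin #E → Fin 2 → Fin #V
    sgn      : Fin #E → Sign

data Arrow : Set where
  toward away : Arrow

_≟ᵃ_ : (x y : Arrow) → Dec (x ≡ y)
toward ≟ᵃ toward = yes refl
toward ≟ᵃ away   = no λ ()
away   ≟ᵃ toward = no λ ()
away   ≟ᵃ away   = yes refl

-- "toward" means toward the vertex at which the half-edge is attached.
record Orientation (G : SignedGraph) : Set where
  open SignedGraph G
  field
    arrow    : Fin #E → Fin 2 → Arrow
    positive : ∀ e → sgn e ≡ Sign.+ → arrow e 0F ≢ arrow e 1F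
    negative : ∀ e → sgn e ≡ Sign.- → arrow e 0F ≡ arrow e 1F

module _ {G : SignedGraph} (O : Orientation G) where
  open SignedGraph G
  open Orientation O

  record Step (u v : Fin #V) : Set where
    field
      edge   : Fin #E
      end    : Fin 2
      source : endpoint edge end ≡ u
      target : endpoint edge (opposite end) ≡ v

  Walk : Fin #V → Fin #V → Set
  Walk = Star Step

  vertices : ∀ {u v} → Walk u v → List (Fin #V)
  vertices {u} ε       = u ∷ []
  vertices {u} (_ ◅ w) = u ∷ vertices w

  edges : ∀ {u v} → Walk u v → List (Fin #E)
  edges ε       = []
  edges (s ◅ w) = Step.edge s ∷ edges w

  -- Some edge in es carries the arrow x at the vertex v.
  HasArrow : Arrow → List (Fin #E) → Fin #V → Set
  HasArrow x es v = ∃[ e ] ∃[ h ] e ∈ es × endpoint e h ≡ v × arrow e h ≡ x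

  -- The walk of length zero is not a cycle: it has no edges, hence no arrows.
  IsCycle : ∀ {v} → Walk v v → Set
  IsCycle w = All (λ v → HasArrow toward (edges w) v × HasArrow away (edges w) v) (vertices w)

  Acyclic : Set
  Acyclic = ∀ {v} (w : Walk v v) → ¬ IsCycle w

  IsSink : Fin #V → Set
  IsSink v = ∀ e h → endpoint e h ≡ v → arrow e h ≡ toward

  isSink? : ∀ v → Dec (IsSink v)
  isSink? v = Fin.all? λ e → Fin.all? λ h →
    (endpoint e h Fin.≟ v) →-dec (arrow e h ≟ᵃ toward)

record SignedPoset : Set where
  field
    graph       : SignedGraph
    orientation : Orientation graph
    acyclic     : Acyclic orientation
  open SignedGraph graph public
  open Orientation orientation public

sink : SignedPoset → ℕ
sink P = length (filter (isSink? orientation) (allFin #V))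
  where open SignedPoset P

module _ (P : SignedPoset) where
  open SignedPoset P

  Coloring : Set
  Coloring = Vec ℤ #V

  Proper : Coloring → Set
  Proper κ = ∀ e h →
    lookup κ (endpoint e h) ≢ sgn e ⊙ lookup κ (endpoint e (opposite h))

  Preserves : Coloring → Set
  Preserves κ = ∀ e h →
    arrow e h ≡ toward ⇔
    lookup κ (endpoint e h) ℤ.> sgn e ⊙ lookup κ (endpoint e (opposite h))

  proper? : ∀ κ → Dec (Proper κ)
  proper? κ = Fin.all? λ e → Fin.all? λ h → ¬? (_ ℤ.≟ _)

  preserves? : ∀ κ → Dec (Preserves κ)
  preserves? κ = Fin.all? λ e → Fin.all? λ h →
    let into? = arrow e h ≟ᵃ toward ; above? = _ ℤ.<? _
    in map′ (λ (f , g) → mk⇔ f g) (λ eq → Equivalence.to eq , Equivalence.from eq)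
            ((into? →-dec above?) ×-dec (above? →-dec into?))

-- The list i₁ ∷ … ∷ iₖ ∷ [] stands for the monomial x_{i₁} ⋯ x_{iₖ};
-- two lists stand for the same monomial iff they are related by _↭_.
Monomial : Set
Monomial = List ℤ

_↭?_ : (m m′ : Monomial) → Dec (m ↭ m′)
[]      ↭? []       = yes ↭-refl
[]      ↭? (j ∷ m′) = no λ p → ¬x∷xs↭[] (↭-sym p)
(i ∷ m) ↭? m′ with i ∈? m′
... | no i∉m′ = no λ p → i∉m′ (∈-resp-↭ p (here refl))
... | yes i∈m′ with ∈-∃++ i∈m′
...   | (l , r , refl) = map′ (λ p → ↭-trans (prep i p) (↭-sym (shift i l r)))
                              (λ p → drop-∷ (↭-trans p (shift i l r)))
                              (m ↭? (l ++ r))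

-- A formal power series in the x_i, given by its coefficients.  Invariance under
-- _↭_ is not imposed: it holds for all series used below, whose coefficients
-- count indices whose monomial is _↭_-equal to m.
Series : Set
Series = Monomial → ℚ

_≈ˢ_ : Series → Series → Set
f ≈ˢ g = ∀ m → f m ≡ g m

support : Monomial → List ℤ
support = deduplicate ℤ._≟_

vectors : List ℤ → (n : ℕ) → List (Vec ℤ n)
vectors is zero    = [] ∷ []
vectors is (suc n) = cartesianProductWith _∷_ is (vectors is n)

-- The coefficient of m in Y_P is the number of proper colorings κ preserving P
-- with ∏ᵥ x_{κ(v)} = m; every such κ takes its values in the support of m.
Yˢ : SignedPoset → Series
Yˢ P m = + length (filter (λ κ → proper? P κ ×-dec (preserves? P κ ×-dec (toList κ ↭? m)))
                          (vectors (support m) #V)) / 1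
  where open SignedPoset P

-- The coefficient of m in p_{a,b} is the number of i ∈ ℤ with x_i^a x_{-i}^b = m;
-- every such i is in the support of m because a ≥ 1.
p : (a b : ℕ) .{{_ : NonZero a}} → Series
p a b m = + length (filter (λ i → (replicate a i ++ replicate b (ℤ.- i)) ↭? m) (support m)) / 1

combination : List (ℚ × SignedPoset) → Series
combination []            m = 0ℚ
combination ((q , P) ∷ c) m = q ℚ.* Yˢ P m ℚ.+ combination c m

record InSpan (f : Series) : Set where
  constructor _,_
  field
    terms : List (ℚ × SignedPoset)
    equal : f ≈ˢ combination terms

span-Y : ∀ P → InSpan (Yˢ P)
span-Y P = (1ℚ , P) ∷ [] , λ m → sym (trans (ℚ.+-identityʳ (1ℚ ℚ.* Yˢ P m)) (ℚ.*-identityˡ (Yˢ P m)))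

span-+ : ∀ {f g} → InSpan f → InSpan g → InSpan (λ m → f m ℚ.+ g m)
span-+ (c , f≈c) (d , g≈d) = c ++ d , λ m → trans (cong₂ ℚ._+_ (f≈c m) (g≈d m)) (go c m)
  where
  go : ∀ c m → combination c m ℚ.+ combination d m ≡ combination (c ++ d) m
  go []            m = ℚ.+-identityˡ (combination d m)
  go ((q , P) ∷ c) m = trans (ℚ.+-assoc (q ℚ.* Yˢ P m) (combination c m) (combination d m)) (cong (q ℚ.* Yˢ P m ℚ.+_) (go c m))

span-* : ∀ r {f} → InSpan f → InSpan (λ m → r ℚ.* f m)
span-* r (c , f≈c) = scale c , λ m → trans (cong (r ℚ.*_) (f≈c m)) (go c m)
  where
  scale : List (ℚ × SignedPoset) → List (ℚ × SignedPoset)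
  scale = map λ (q , P) → r ℚ.* q , P
  go : ∀ c m → r ℚ.* combination c m ≡ combination (scale c) m
  go []            m = ℚ.*-zeroʳ r
  go ((q , P) ∷ c) m = trans (ℚ.*-distribˡ-+ r (q ℚ.* Yˢ P m) (combination c m))
                             (cong₂ ℚ._+_ (sym (ℚ.*-assoc r q (Yˢ P m))) (go c m))

span-neg : ∀ {f} → InSpan f → InSpan (λ m → ℚ.- f m)
span-neg {f} s with c , -f≈c ← span-* (ℚ.- 1ℚ) s =
  c , λ m → trans (trans (cong ℚ.-_ (sym (ℚ.*-identityˡ (f m)))) (ℚ.neg-distribˡ-* 1ℚ (f m)))
                  (-f≈c m)

𝕐 : RawLeftModule ℚ 0ℓ 0ℓ
𝕐 = record
  { Carrierᴹ = Σ Series InSpan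
  ; _≈ᴹ_     = λ F G → proj₁ F ≈ˢ proj₁ G
  ; _+ᴹ_     = λ (f , s) (g , s′) → (λ m → f m ℚ.+ g m) , span-+ s s′
  ; _*ₗ_     = λ r (f , s) → (λ m → r ℚ.* f m) , span-* r s
  ; 0ᴹ       = (λ _ → 0ℚ) , [] , λ _ → refl
  ; -ᴹ_      = λ (f , s) → (λ m → ℚ.- f m) , span-neg s
  }

Y : SignedPoset → RawLeftModule.Carrierᴹ 𝕐
Y P = Yˢ P , span-Y P

-- The list a₀ ∷ a₁ ∷ … ∷ aₖ ∷ [] stands for a₀ + a₁ t + ⋯ + aₖ tᵏ; trailing
-- zeros are allowed, so equality is equality of all coefficients.
Poly : Set
Poly = List ℚ

coeff : Poly → ℕ → ℚ
coeff []      _       = 0ℚ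
coeff (a ∷ f) zero    = a
coeff (a ∷ f) (suc k) = coeff f k

_+ᵖ_ : Poly → Poly → Poly
[]      +ᵖ g       = g
(a ∷ f) +ᵖ []      = a ∷ f
(a ∷ f) +ᵖ (b ∷ g) = (a ℚ.+ b) ∷ (f +ᵖ g)

_·ᵖ_ : ℚ → Poly → Poly
r ·ᵖ f = map (r ℚ.*_) f

_*ᵖ_ : Poly → Poly → Poly
[]      *ᵖ g = []
(a ∷ f) *ᵖ g = (a ·ᵖ g) +ᵖ (0ℚ ∷ (f *ᵖ g))

ℚ[t] : RawRing 0ℓ 0ℓ
ℚ[t] = record
  { Carrier = Poly
  ; _≈_     = λ f g → ∀ k → coeff f k ≡ coeff g k
  ; _+_     = _+ᵖ_
  ; _*_     = _*ᵖ_
  ; -_      = map (λ a → ℚ.- a)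
  ; 0#      = []
  ; 1#      = 1ℚ ∷ []
  }

open RawRing ℚ[t] public using (_≈_; 1#; -_)
open Algebra.Definitions.RawSemiring (RawRing.rawSemiring ℚ[t]) public using (_^_)

ℚ[t]-module : RawLeftModule ℚ 0ℓ 0ℓ
ℚ[t]-module = record
  { Carrierᴹ = Poly
  ; _≈ᴹ_     = _≈_
  ; _+ᴹ_     = _+ᵖ_
  ; _*ₗ_     = _·ᵖ_
  ; 0ᴹ       = []
  ; -ᴹ_      = -_
  }

t : Poly
t = 0ℚ ∷ 1ℚ ∷ []

infixl 6 _-_
_-_ : Poly → Poly → Poly
f - g = f +ᵖ (- g)

open Morphism.LeftModuleMorphisms 𝕐 ℚ[t]-module public
  using () renaming (IsLeftModuleHomomorphism to IsLinear)

{-# OPTIONS --safe #-}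
-- The indicator of x₀ = x₁ = ⋯ = xₙ is ∏ᵢ (1 − [x₀ < xᵢ] − [xᵢ < x₀]).  Expanding the
-- product writes p_{n+1,0} as the signed sum of Y_P over all orientations P of all subgraphs
-- of a star with centre x₀ and n leaves.  Under φ a leaf that is isolated, above the centre
-- or below it contributes t, −t, −1 respectively, and the centre is a sink iff no leaf lies
-- above it, so the sum becomes t (t − 1)ⁿ + ((t − t − 1)ⁿ − (t − 1)ⁿ).
module Submission where

open import Defs
open import Algebra.Module.Bundles.Raw using (RawLeftModule)
open import Data.Bool.Base using (true; false; if_then_else_; _∧_)
open import Data.Empty using (⊥-elim)
open import Data.Fin.Base using (Fin; zero; suc)
open import Data.Fin.Patterns using (0F; 1F)
open import Data.Integer.Base as ℤ using (ℤ; +_)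
import Data.Integer.Properties as ℤ
open import Data.List.Base using (List; []; _∷_; _++_; map; length; filter; replicate; tabulate; cartesianProductWith)
open import Data.List.Membership.Propositional using (_∈_)
open import Data.List.Properties using (++-identityʳ)
open import Data.List.Relation.Unary.All as All using (_∷_)
open import Data.List.Relation.Unary.AllPairs using (_∷_)
open import Data.List.Relation.Unary.Any using (here; there)
open import Data.List.Relation.Unary.Unique.DecPropositional.Properties ℤ._≟_ using (deduplicate-!)
open import Data.List.Relation.Unary.Unique.Propositional using (Unique)
open import Data.Maybe.Base using (Maybe; just; nothing)
open import Data.Maybe.Properties using (just-injective)
open import Data.Nat.Base using (ℕ; zero; suc; NonZero)
open import Data.Product.Base using (Σ; _×_; _,_; proj₁; proj₂; map₁; ∃-syntax)
open import Data.Rational as ℚ using (ℚ; 0ℚ; 1ℚ; _/_)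
import Data.Rational.Properties as ℚ
import Data.Rational.Unnormalised.Base as ℚᵘ
import Data.Rational.Unnormalised.Properties as ℚᵘ
open import Data.Rational.Solver using (module +-*-Solver)
import Data.Sign.Base as Sign
open import Data.Unit.Base using (⊤; tt)
open import Data.Vec.Base as Vec using (Vec; []; _∷_; lookup; toList)
open import Data.Vec.Properties using (toList-replicate)
import Data.Vec.Relation.Unary.All as Vecᴬ
open import Data.Vec.Relation.Binary.Pointwise.Inductive as Pointwise using (Pointwise; []; _∷_)
open import Function.Base using (_∘_; case_of_)
open import Function.Bundles using (_⇔_; mk⇔; Equivalence)
open import Relation.Binary.Construct.Closure.ReflexiveTransitive using (ε; _◅_)
open import Relation.Binary.Definitions using (tri<; tri≈; tri>)
open import Relation.Binary.PropositionalEquality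
import Relation.Binary.Reasoning.Setoid as ≃-Reasoning
open import Relation.Nullary using (Dec; yes; no; ¬_; does; _×-dec_)
open import Relation.Nullary.Decidable using (does-⇔; dec-true; dec-false)
open import Relation.Unary using (Decidable)

open +-*-Solver using (solve; _:=_; _:+_; _:*_; :-_; con)

private
  variable
    A B C : Set
    n : ℕ

-- Finite sums of rationals.

∑ : List A → (A → ℚ) → ℚ
∑ []       f = 0ℚ
∑ (x ∷ xs) f = f x ℚ.+ ∑ xs f

syntax ∑ xs (λ x → e) = ∑[ x ∈ xs ] e
infixr 8 ∑

∑-cong-∈ : ∀ (xs : List A) {f g} → (∀ {x} → x ∈ xs → f x ≡ g x) → ∑ xs f ≡ ∑ xs g
∑-cong-∈ []       f≡g = refl
∑-cong-∈ (x ∷ xs) f≡g = cong₂ ℚ._+_ (f≡g (here refl)) (∑-cong-∈ xs (f≡g ∘ there))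

∑-cong : ∀ (xs : List A) {f g} → (∀ x → f x ≡ g x) → ∑ xs f ≡ ∑ xs g
∑-cong xs f≡g = ∑-cong-∈ xs (λ {x} _ → f≡g x)

∑-map : ∀ (h : A → B) xs {f} → ∑ (map h xs) f ≡ ∑ xs (f ∘ h)
∑-map h []           = refl
∑-map h (x ∷ xs) {f} = cong (f (h x) ℚ.+_) (∑-map h xs)

∑-++ : ∀ (xs ys : List A) {f} → ∑ (xs ++ ys) f ≡ ∑ xs f ℚ.+ ∑ ys f
∑-++ []       ys     = sym (ℚ.+-identityˡ _)
∑-++ (x ∷ xs) ys {f} = trans (cong (f x ℚ.+_) (∑-++ xs ys)) (sym (ℚ.+-assoc (f x) _ _))

∑-cartesianProductWith : ∀ (h : A → B → C) xs ys {f} →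
  ∑ (cartesianProductWith h xs ys) f ≡ ∑[ x ∈ xs ] ∑[ y ∈ ys ] f (h x y)
∑-cartesianProductWith h []       ys = refl
∑-cartesianProductWith h (x ∷ xs) ys =
  trans (∑-++ (map (h x) ys) _) (cong₂ ℚ._+_ (∑-map (h x) ys) (∑-cartesianProductWith h xs ys))

∑-zero : ∀ (xs : List A) → ∑[ x ∈ xs ] 0ℚ ≡ 0ℚ
∑-zero []       = refl
∑-zero (x ∷ xs) = trans (ℚ.+-identityˡ _) (∑-zero xs)

∑-+ : ∀ (xs : List A) f g → ∑[ x ∈ xs ] (f x ℚ.+ g x) ≡ ∑ xs f ℚ.+ ∑ xs g
∑-+ []       f g = refl
∑-+ (x ∷ xs) f g = trans (cong (f x ℚ.+ g x ℚ.+_) (∑-+ xs f g))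
  (solve 4 (λ a b c d → (a :+ b) :+ (c :+ d) := (a :+ c) :+ (b :+ d)) refl (f x) (g x) (∑ xs f) (∑ xs g))

∑-*ˡ : ∀ (xs : List A) r f → ∑[ x ∈ xs ] (r ℚ.* f x) ≡ r ℚ.* ∑ xs f
∑-*ˡ []       r f = sym (ℚ.*-zeroʳ r)
∑-*ˡ (x ∷ xs) r f = trans (cong (r ℚ.* f x ℚ.+_) (∑-*ˡ xs r f)) (sym (ℚ.*-distribˡ-+ r (f x) _))

∑-*ʳ : ∀ (xs : List A) r f → ∑[ x ∈ xs ] (f x ℚ.* r) ≡ ∑ xs f ℚ.* r
∑-*ʳ xs r f = trans (∑-cong xs (λ x → ℚ.*-comm (f x) r)) (trans (∑-*ˡ xs r f) (ℚ.*-comm r _))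

∑-swap : ∀ (xs : List A) (ys : List B) (f : A → B → ℚ) →
  ∑[ x ∈ xs ] ∑[ y ∈ ys ] f x y ≡ ∑[ y ∈ ys ] ∑[ x ∈ xs ] f x y
∑-swap []       ys f = sym (∑-zero ys)
∑-swap (x ∷ xs) ys f = trans (cong (∑ ys (f x) ℚ.+_) (∑-swap xs ys f)) (sym (∑-+ ys (f x) _))

-- Indicators of decidable propositions, and counting as summation.

⟦_⟧ : Dec A → ℚ
⟦ d ⟧ = if does d then 1ℚ else 0ℚ

⟦⟧-⇔ : A ⇔ B → (a? : Dec A) (b? : Dec B) → ⟦ a? ⟧ ≡ ⟦ b? ⟧
⟦⟧-⇔ A⇔B a? b? = cong (if_then 1ℚ else 0ℚ) (does-⇔ A⇔B a? b?)

if-∧ : ∀ x y → (if x ∧ y then 1ℚ else 0ℚ) ≡ (if x then 1ℚ else 0ℚ) ℚ.* (if y then 1ℚ else 0ℚ)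
if-∧ false y = sym (ℚ.*-zeroˡ (if y then 1ℚ else 0ℚ))
if-∧ true  y = sym (ℚ.*-identityˡ (if y then 1ℚ else 0ℚ))

⟦⟧-× : (a? : Dec A) (b? : Dec B) → ⟦ a? ×-dec b? ⟧ ≡ ⟦ a? ⟧ ℚ.* ⟦ b? ⟧
⟦⟧-× a? b? = if-∧ (does a?) (does b?)

-- The operation `_/_` normalises by a gcd and does not reduce for a variable `n`, so the equation
-- is transported to unnormalised rationals, where it is an identity between integers.
suc/1 : ∀ n → + suc n / 1 ≡ 1ℚ ℚ.+ + n / 1
suc/1 n = ℚ.toℚᵘ-injective (begin
  ℚ.toℚᵘ (+ suc n / 1)             ≈⟨ ℚ.toℚᵘ-fromℚᵘ (ℚᵘ.mkℚᵘ (+ suc n) 0) ⟩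
  ℚᵘ.mkℚᵘ (+ suc n) 0              ≈⟨ ℚᵘ.*≡* (cong (λ i → (+ 1 ℤ.+ i) ℤ.* + 1) (sym (ℤ.*-identityʳ (+ n)))) ⟩
  ℚᵘ.1ℚᵘ ℚᵘ.+ ℚᵘ.mkℚᵘ (+ n) 0      ≈⟨ ℚᵘ.+-congʳ ℚᵘ.1ℚᵘ (ℚ.toℚᵘ-fromℚᵘ (ℚᵘ.mkℚᵘ (+ n) 0)) ⟨
  ℚ.toℚᵘ 1ℚ ℚᵘ.+ ℚ.toℚᵘ (+ n / 1)  ≈⟨ ℚ.toℚᵘ-homo-+ 1ℚ (+ n / 1) ⟨
  ℚ.toℚᵘ (1ℚ ℚ.+ + n / 1)          ∎)
  where open ≃-Reasoning ℚᵘ.≃-setoid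

-- Turns the counts that define `Yˢ` and `p` into sums of indicators, which can be factored and
-- interchanged.
length-filter : ∀ {P : A → Set} (P? : Decidable P) xs →
  + length (filter P? xs) / 1 ≡ ∑[ x ∈ xs ] ⟦ P? x ⟧
length-filter P? []       = refl
length-filter P? (x ∷ xs) with does (P? x)
... | true  = trans (suc/1 (length (filter P? xs))) (cong (1ℚ ℚ.+_) (length-filter P? xs))
... | false = trans (length-filter P? xs) (sym (ℚ.+-identityˡ _))

-- Oriented subgraphs of a star, as signed posets.

-- just y stands for an edge from the centre to the leaf whose arrow at the leaf is y.
Leaf : Set
Leaf = Maybe Arrow

flip : Arrow → Arrow
flip toward = away
flip away   = toward

#edges : Vec Leaf n → ℕ
#edges []            = 0
#edges (nothing ∷ c) = #edges c
#edges (just _ ∷ c)  = suc (#edges c)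

edge : (c : Vec Leaf n) → Fin (#edges c) → Fin n × Arrow
edge (nothing ∷ c) e       = map₁ suc (edge c e)
edge (just y ∷ c)  zero    = zero , y
edge (just y ∷ c)  (suc e) = map₁ suc (edge c e)

lookup-edge : (c : Vec Leaf n) (e : Fin (#edges c)) → lookup c (proj₁ (edge c e)) ≡ just (proj₂ (edge c e))
lookup-edge (nothing ∷ c) e       = lookup-edge c e
lookup-edge (just y ∷ c)  zero    = refl
lookup-edge (just y ∷ c)  (suc e) = lookup-edge c e

edge-surjective : (c : Vec Leaf n) → ∀ i {y} → lookup c i ≡ just y → ∃[ e ] edge c e ≡ (i , y)
edge-surjective (just y ∷ c)  zero    refl = zero , refl
edge-surjective (nothing ∷ c) (suc i) eq   = let e , p = edge-surjective c i eq in e , cong (map₁ suc) p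
edge-surjective (just y ∷ c)  (suc i) eq   = let e , p = edge-surjective c i eq in suc e , cong (map₁ suc) p

-- All edges are positive because the colour of the centre is compared with the colour of the leaf
-- itself, not with its negative. End `0F` of an edge is at the centre, end `1F` at the leaf.
starGraph : Vec Leaf n → SignedGraph
starGraph {n} c = record
  { #V = suc n
  ; #E = #edges c
  ; endpoint = λ { e 0F → zero ; e 1F → suc (proj₁ (edge c e)) }
  ; sgn = λ _ → Sign.+
  }

starOrientation : (c : Vec Leaf n) → Orientation (starGraph c)
starOrientation c = record
  { arrow = λ { e 0F → flip (proj₂ (edge c e)) ; e 1F → proj₂ (edge c e) }
  ; positive = λ e _ → flip-≢ (proj₂ (edge c e))
  ; negative = λ _ ()
  }
  where
  flip-≢ : ∀ y → flip y ≢ y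
  flip-≢ toward ()
  flip-≢ away   ()

module _ {G : SignedGraph} (O : Orientation G) where
  open SignedGraph G

  head∈vertices : ∀ {u v} (w : Walk O u v) → u ∈ vertices O w
  head∈vertices ε       = here refl
  head∈vertices (_ ◅ _) = here refl

  -- The step that uses `e` leaves from one endpoint and the remaining walk begins at the other;
  -- `Step.end` tells which is which.
  endpoint∈vertices : ∀ {u v} (w : Walk O u v) {e} → e ∈ edges O w → ∀ h → endpoint e h ∈ vertices O w
  endpoint∈vertices (s ◅ w) (there e∈w) h = there (endpoint∈vertices w e∈w h)
  endpoint∈vertices (s ◅ w) (here refl) h with Step.end s | Step.source s | Step.target s | h
  ... | 0F | source | target | 0F = here source
  ... | 0F | source | target | 1F = there (subst (_∈ vertices O w) (sym target) (head∈vertices w))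
  ... | 1F | source | target | 0F = there (subst (_∈ vertices O w) (sym target) (head∈vertices w))
  ... | 1F | source | target | 1F = here source

-- End `0F` lies at the centre, so only end `1F` can meet a leaf, and the arrow there is the one
-- recorded in `c`. All half-edges at one leaf therefore carry the same arrow.
arrow-at-leaf : (c : Vec Leaf n) → ∀ {e h i} → let open SignedGraph (starGraph c) in
  endpoint e h ≡ suc i → just (Orientation.arrow (starOrientation c) e h) ≡ lookup c i
arrow-at-leaf c {e} {1F} refl = sym (lookup-edge c e)

-- Every edge of a cycle has a leaf as an endpoint, and no leaf carries both arrows.
starAcyclic : (c : Vec Leaf n) → Acyclic (starOrientation c)
starAcyclic c w cycle
  with (_ , _ , e∈w , _) , _ ← All.lookup cycle (head∈vertices (starOrientation c) w)
  with (_ , _ , _ , v₁ , toward₁) , (_ , _ , _ , v₂ , away₂) ←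
       All.lookup cycle (endpoint∈vertices (starOrientation c) w e∈w 1F)
  = case trans (sym toward₁) (trans (just-injective (trans (arrow-at-leaf c v₁) (sym (arrow-at-leaf c v₂)))) away₂) of λ ()

star : Vec Leaf n → SignedPoset
star c = record { graph = starGraph c ; orientation = starOrientation c ; acyclic = starAcyclic c }

-- Proper colorings that preserve a star.

Obeys : ℤ → Leaf → ℤ → Set
Obeys x nothing       y = ⊤
Obeys x (just toward) y = x ℤ.< y
Obeys x (just away)   y = y ℤ.< x

obeys? : ∀ x l y → Dec (Obeys x l y)
obeys? x nothing       y = yes tt
obeys? x (just toward) y = x ℤ.<? y
obeys? x (just away)   y = y ℤ.<? x

-- Isolated leaves impose only `⊤`, and every other leaf has an edge by `edge-surjective`, so
-- conditions per leaf and per edge agree.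
Pointwise-edge : (c : Vec Leaf n) (x : ℤ) (κ : Vec ℤ n) →
  Pointwise (Obeys x) c κ ⇔ (∀ e → Obeys x (just (proj₂ (edge c e))) (lookup κ (proj₁ (edge c e))))
Pointwise-edge c x κ = mk⇔
  (λ obeys e → subst (λ l → Obeys x l (lookup κ (proj₁ (edge c e)))) (lookup-edge c e) (Pointwise.lookup obeys (proj₁ (edge c e))))
  (λ obeys → Pointwise-lookup (at obeys))
  where
  Pointwise-lookup : ∀ {n} {c : Vec Leaf n} {κ : Vec ℤ n} → (∀ i → Obeys x (lookup c i) (lookup κ i)) → Pointwise (Obeys x) c κ
  Pointwise-lookup {c = []}    {[]}    f = []
  Pointwise-lookup {c = _ ∷ _} {_ ∷ _} f = f zero ∷ Pointwise-lookup (f ∘ suc)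
  at : (∀ e → Obeys x (just (proj₂ (edge c e))) (lookup κ (proj₁ (edge c e)))) →
       ∀ i → Obeys x (lookup c i) (lookup κ i)
  at obeys i with lookup c i in eq
  ... | nothing = tt
  ... | just y with e , p ← edge-surjective c i eq =
    subst (λ (i , y) → Obeys x (just y) (lookup κ i)) p (obeys e)

-- The conditions at the two ends of an edge are one strict inequality read from opposite sides, and
-- strictness makes the two colours distinct.
star-colorings : (c : Vec Leaf n) (x : ℤ) (κ : Vec ℤ n) →
  (Proper (star c) (x ∷ κ) × Preserves (star c) (x ∷ κ)) ⇔ Pointwise (Obeys x) c κ
star-colorings c x κ = mk⇔
  (λ (_ , preserves) → Equivalence.from (Pointwise-edge c x κ) (λ e → obeys _ (preserves e 0F) (preserves e 1F)))
  (λ pw → let obeyed = Equivalence.to (Pointwise-edge c x κ) pw in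
    (λ { e 0F → proper _ (obeyed e) ; e 1F → proper _ (obeyed e) ∘ sym }) ,
    (λ { e 0F → preserves₀ _ (obeyed e) ; e 1F → preserves₁ _ (obeyed e) }))
  where
  -- The inequality is read off at the end whose arrow is `toward`; the other end yields only a
  -- negation.
  obeys : ∀ a {y} → flip a ≡ toward ⇔ y ℤ.< x → a ≡ toward ⇔ x ℤ.< y → Obeys x (just a) y
  obeys toward _ at-leaf   = Equivalence.to at-leaf refl
  obeys away   at-centre _ = Equivalence.to at-centre refl
  proper : ∀ a {y} → Obeys x (just a) y → x ≢ y
  proper toward x<y refl = ℤ.<-irrefl refl x<y
  proper away   y<x refl = ℤ.<-irrefl refl y<x
  preserves₀ : ∀ a {y} → Obeys x (just a) y → flip a ≡ toward ⇔ y ℤ.< x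
  preserves₀ toward x<y = mk⇔ (λ ()) (⊥-elim ∘ ℤ.<-asym x<y)
  preserves₀ away   y<x = mk⇔ (λ _ → y<x) (λ _ → refl)
  preserves₁ : ∀ a {y} → Obeys x (just a) y → a ≡ toward ⇔ x ℤ.< y
  preserves₁ toward x<y = mk⇔ (λ _ → x<y) (λ _ → refl)
  preserves₁ away   y<x = mk⇔ (λ ()) (⊥-elim ∘ ℤ.<-asym y<x)

-- The signed sum over all stars collapses to the indicator of a constant coloring.

leaves : List Leaf
leaves = nothing ∷ just toward ∷ just away ∷ []

choices : ∀ n → List (Vec Leaf n)
choices zero    = [] ∷ []
choices (suc n) = cartesianProductWith _∷_ leaves (choices n)

leafWeight : Leaf → ℚ
leafWeight nothing  = 1ℚ
leafWeight (just _) = ℚ.- 1ℚ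

weight : Vec Leaf n → ℚ
weight []      = 1ℚ
weight (l ∷ c) = leafWeight l ℚ.* weight c

terms : ℕ → List (ℚ × SignedPoset)
terms n = map (λ c → weight c , star c) (choices n)

-- By trichotomy the sum is `1 − 0 − 0` if `x ≡ y`; otherwise exactly one of the two strict
-- inequalities holds and cancels the `1`.
∑-leaves : ∀ x y → ∑[ l ∈ leaves ] (leafWeight l ℚ.* ⟦ obeys? x l y ⟧) ≡ ⟦ x ℤ.≟ y ⟧
∑-leaves x y with ℤ.<-cmp x y
... | tri< x<y x≢y y≮x rewrite dec-true (x ℤ.<? y) x<y | dec-false (x ℤ.≟ y) x≢y | dec-false (y ℤ.<? x) y≮x = refl
... | tri≈ x≮y x≡y y≮x rewrite dec-false (x ℤ.<? y) x≮y | dec-true (x ℤ.≟ y) x≡y | dec-false (y ℤ.<? x) y≮x = refl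
... | tri> x≮y x≢y y<x rewrite dec-false (x ℤ.<? y) x≮y | dec-false (x ℤ.≟ y) x≢y | dec-true (y ℤ.<? x) y<x = refl

-- For a fixed colour `x` of the centre, weight and indicator are both products over the leaves, so
-- the sum factors leaf by leaf and `∑-leaves` evaluates each factor.
∑-choices : ∀ x (κ : Vec ℤ n) →
  ∑[ c ∈ choices n ] (weight c ℚ.* ⟦ Pointwise.decidable (obeys? x) c κ ⟧) ≡ ⟦ Vecᴬ.all? (x ℤ.≟_) κ ⟧
∑-choices         x []      = refl
∑-choices {suc n} x (y ∷ κ) = begin
  ∑[ c ∈ choices (suc n) ] (weight c ℚ.* ⟦ obey? c (y ∷ κ) ⟧)
    ≡⟨ ∑-cartesianProductWith _∷_ leaves (choices n) ⟩
  ∑[ l ∈ leaves ] ∑[ c ∈ choices n ] (leafWeight l ℚ.* weight c ℚ.* ⟦ obeys? x l y ×-dec obey? c κ ⟧)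
    ≡⟨ ∑-cong leaves (λ l → trans (∑-cong (choices n) (factor l)) (∑-*ˡ (choices n) (leafWeight l ℚ.* ⟦ obeys? x l y ⟧) _)) ⟩
  ∑[ l ∈ leaves ] (leafWeight l ℚ.* ⟦ obeys? x l y ⟧ ℚ.* ∑[ c ∈ choices n ] (weight c ℚ.* ⟦ obey? c κ ⟧))
    ≡⟨ ∑-*ʳ leaves _ (λ l → leafWeight l ℚ.* ⟦ obeys? x l y ⟧) ⟩
  ∑[ l ∈ leaves ] (leafWeight l ℚ.* ⟦ obeys? x l y ⟧) ℚ.* ∑[ c ∈ choices n ] (weight c ℚ.* ⟦ obey? c κ ⟧)
    ≡⟨ cong₂ ℚ._*_ (∑-leaves x y) (∑-choices x κ) ⟩
  ⟦ x ℤ.≟ y ⟧ ℚ.* ⟦ Vecᴬ.all? (x ℤ.≟_) κ ⟧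
    ≡⟨ ⟦⟧-× (x ℤ.≟ y) (Vecᴬ.all? (x ℤ.≟_) κ) ⟨
  ⟦ Vecᴬ.all? (x ℤ.≟_) (y ∷ κ) ⟧ ∎
  where
  open ≡-Reasoning
  obey? : ∀ {n} (c : Vec Leaf n) (κ : Vec ℤ n) → Dec (Pointwise (Obeys x) c κ)
  obey? = Pointwise.decidable (obeys? x)
  factor : ∀ l c → leafWeight l ℚ.* weight c ℚ.* ⟦ obeys? x l y ×-dec obey? c κ ⟧ ≡
                   leafWeight l ℚ.* ⟦ obeys? x l y ⟧ ℚ.* (weight c ℚ.* ⟦ obey? c κ ⟧)
  factor l c = trans (cong (leafWeight l ℚ.* weight c ℚ.*_) (⟦⟧-× (obeys? x l y) (obey? c κ)))
    (solve 4 (λ a b c d → a :* b :* (c :* d) := a :* c :* (b :* d)) refl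
      (leafWeight l) (weight c) ⟦ obeys? x l y ⟧ ⟦ obey? c κ ⟧)

-- Summation against indicators of equality.

-- As `xs` has no repetitions, `x` is matched exactly once and the indicator acts as a Kronecker
-- delta.
∑-⟦≟⟧ : ∀ {xs x} → Unique xs → x ∈ xs → ∀ (f : ℤ → ℚ) → ∑[ y ∈ xs ] (⟦ x ℤ.≟ y ⟧ ℚ.* f y) ≡ f x
∑-⟦≟⟧ {x ∷ xs} (x∉xs ∷ _) (here refl) f = trans
  (cong₂ ℚ._+_
    (cong (λ b → (if b then 1ℚ else 0ℚ) ℚ.* f x) (dec-true (x ℤ.≟ x) refl))
    (trans (∑-cong-∈ xs (λ {y} y∈xs → trans
             (cong (λ b → (if b then 1ℚ else 0ℚ) ℚ.* f y) (dec-false (x ℤ.≟ y) (All.lookup x∉xs y∈xs)))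
             (ℚ.*-zeroˡ (f y))))
           (∑-zero xs)))
  (solve 1 (λ a → con 1ℚ :* a :+ con 0ℚ := a) refl (f x))
∑-⟦≟⟧ {y ∷ xs} {x} (y∉xs ∷ uniq) (there x∈xs) f = trans
  (cong₂ ℚ._+_
    (trans (cong (λ b → (if b then 1ℚ else 0ℚ) ℚ.* f y) (dec-false (x ℤ.≟ y) (All.lookup y∉xs x∈xs ∘ sym)))
           (ℚ.*-zeroˡ (f y)))
    (∑-⟦≟⟧ uniq x∈xs f))
  (ℚ.+-identityˡ (f x))

-- The indicator of a constant vector is a product of Kronecker deltas, one per coordinate, and
-- `∑-⟦≟⟧` removes them one at a time.
∑-constant : ∀ {xs x} → Unique xs → x ∈ xs → ∀ n (f : Vec ℤ n → ℚ) →
  ∑[ κ ∈ vectors xs n ] (⟦ Vecᴬ.all? (x ℤ.≟_) κ ⟧ ℚ.* f κ) ≡ f (Vec.replicate n x)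
∑-constant uniq x∈xs zero f = solve 1 (λ a → con 1ℚ :* a :+ con 0ℚ := a) refl (f [])
∑-constant {xs} {x} uniq x∈xs (suc n) f = begin
  ∑[ κ ∈ vectors xs (suc n) ] (⟦ const? κ ⟧ ℚ.* f κ)
    ≡⟨ ∑-cartesianProductWith _∷_ xs (vectors xs n) ⟩
  ∑[ y ∈ xs ] ∑[ κ ∈ vectors xs n ] (⟦ x ℤ.≟ y ×-dec const? κ ⟧ ℚ.* f (y ∷ κ))
    ≡⟨ ∑-cong xs (λ y → trans (∑-cong (vectors xs n) (factor y)) (∑-*ˡ (vectors xs n) ⟦ x ℤ.≟ y ⟧ _)) ⟩
  ∑[ y ∈ xs ] (⟦ x ℤ.≟ y ⟧ ℚ.* ∑[ κ ∈ vectors xs n ] (⟦ const? κ ⟧ ℚ.* f (y ∷ κ)))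
    ≡⟨ ∑-cong xs (λ y → cong (⟦ x ℤ.≟ y ⟧ ℚ.*_) (∑-constant uniq x∈xs n (f ∘ (y ∷_)))) ⟩
  ∑[ y ∈ xs ] (⟦ x ℤ.≟ y ⟧ ℚ.* f (y ∷ Vec.replicate n x))
    ≡⟨ ∑-⟦≟⟧ uniq x∈xs (λ y → f (y ∷ Vec.replicate n x)) ⟩
  f (Vec.replicate (suc n) x) ∎
  where
  open ≡-Reasoning
  const? : ∀ {n} (κ : Vec ℤ n) → Dec (Vecᴬ.All (x ≡_) κ)
  const? = Vecᴬ.all? (x ℤ.≟_)
  factor : ∀ y (κ : Vec ℤ n) → ⟦ x ℤ.≟ y ×-dec const? κ ⟧ ℚ.* f (y ∷ κ) ≡
                               ⟦ x ℤ.≟ y ⟧ ℚ.* (⟦ const? κ ⟧ ℚ.* f (y ∷ κ))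
  factor y κ = trans (cong (ℚ._* f (y ∷ κ)) (⟦⟧-× (x ℤ.≟ y) (const? κ))) (ℚ.*-assoc ⟦ x ℤ.≟ y ⟧ _ _)

-- The power sum as a combination of series of stars.

combination-∑ : ∀ ts m → combination ts m ≡ ∑[ (q , P) ∈ ts ] (q ℚ.* Yˢ P m)
combination-∑ []             m = refl
combination-∑ ((q , P) ∷ ts) m = cong (q ℚ.* Yˢ P m ℚ.+_) (combination-∑ ts m)

p≈combination : ∀ n → p (suc n) 0 ≈ˢ combination (terms n)
p≈combination n m = sym (begin
  combination (terms n) m
    ≡⟨ combination-∑ (terms n) m ⟩
  ∑[ (q , P) ∈ terms n ] (q ℚ.* Yˢ P m)
    ≡⟨ ∑-map (λ c → weight c , star c) (choices n) ⟩
  ∑[ c ∈ choices n ] (weight c ℚ.* Yˢ (star c) m)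
    ≡⟨ ∑-cong (choices n) (λ c → trans (cong (weight c ℚ.*_) (Yˢ-star c)) (sym (∑-*ˡ colorings (weight c) _))) ⟩
  ∑[ c ∈ choices n ] ∑[ κ ∈ colorings ] (weight c ℚ.* (⟦ obey? c κ ⟧ ℚ.* ⟦ toList κ ↭? m ⟧))
    -- With the coloring fixed first, the inner sum over stars is the one that `∑-choices`
    -- evaluates.
    ≡⟨ ∑-swap (choices n) colorings _ ⟩
  ∑[ κ ∈ colorings ] ∑[ c ∈ choices n ] (weight c ℚ.* (⟦ obey? c κ ⟧ ℚ.* ⟦ toList κ ↭? m ⟧))
    ≡⟨ ∑-cong colorings (λ κ → trans
         (∑-cong (choices n) (λ c → sym (ℚ.*-assoc (weight c) ⟦ obey? c κ ⟧ ⟦ toList κ ↭? m ⟧)))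
         (∑-*ʳ (choices n) ⟦ toList κ ↭? m ⟧ (λ c → weight c ℚ.* ⟦ obey? c κ ⟧))) ⟩
  ∑[ κ ∈ colorings ] (∑[ c ∈ choices n ] (weight c ℚ.* ⟦ obey? c κ ⟧) ℚ.* ⟦ toList κ ↭? m ⟧)
    ≡⟨ ∑-cong colorings (λ κ → cong (ℚ._* ⟦ toList κ ↭? m ⟧) (∑-choices (Vec.head κ) (Vec.tail κ))) ⟩
  ∑[ κ ∈ colorings ] (⟦ Vecᴬ.all? (Vec.head κ ℤ.≟_) (Vec.tail κ) ⟧ ℚ.* ⟦ toList κ ↭? m ⟧)
    ≡⟨ ∑-cartesianProductWith _∷_ (support m) (vectors (support m) n) ⟩
  ∑[ x ∈ support m ] ∑[ κ ∈ vectors (support m) n ] (⟦ Vecᴬ.all? (x ℤ.≟_) κ ⟧ ℚ.* ⟦ toList (x ∷ κ) ↭? m ⟧)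
    ≡⟨ ∑-cong-∈ (support m) (λ {x} x∈ → ∑-constant (deduplicate-! m) x∈ n (λ κ → ⟦ toList (x ∷ κ) ↭? m ⟧)) ⟩
  ∑[ x ∈ support m ] ⟦ toList (Vec.replicate (suc n) x) ↭? m ⟧
    -- The trailing `[]` is the empty block of factors with index `ℤ.- x`, since `b` is `0`.
    ≡⟨ ∑-cong (support m) (λ x → cong (λ m′ → ⟦ m′ ↭? m ⟧) (trans (toList-replicate (suc n) x) (sym (++-identityʳ _)))) ⟩
  ∑[ x ∈ support m ] ⟦ (replicate (suc n) x ++ []) ↭? m ⟧
    ≡⟨ length-filter (λ x → (replicate (suc n) x ++ []) ↭? m) (support m) ⟨
  p (suc n) 0 m ∎)
  where
  open ≡-Reasoning
  colorings : List (Vec ℤ (suc n))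
  colorings = vectors (support m) (suc n)
  obey? : ∀ c (κ : Vec ℤ (suc n)) → Dec (Pointwise (Obeys (Vec.head κ)) c (Vec.tail κ))
  obey? c κ = Pointwise.decidable (obeys? (Vec.head κ)) c (Vec.tail κ)
  Yˢ-star : ∀ c → Yˢ (star c) m ≡ ∑[ κ ∈ colorings ] (⟦ obey? c κ ⟧ ℚ.* ⟦ toList κ ↭? m ⟧)
  Yˢ-star c = trans
    (length-filter (λ κ → proper? (star c) κ ×-dec (preserves? (star c) κ ×-dec (toList κ ↭? m))) colorings)
    (∑-cong colorings λ { κ@(x ∷ κ′) → trans
      (⟦⟧-⇔ (let open Equivalence (star-colorings c x κ′) in
              mk⇔ (λ (prop , pres , perm) → to (prop , pres) , perm)
                  (λ (obeyed , perm) → proj₁ (from obeyed) , proj₂ (from obeyed) , perm))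
            (proper? (star c) κ ×-dec (preserves? (star c) κ ×-dec (toList κ ↭? m)))
            (obey? c κ ×-dec (toList κ ↭? m)))
      (⟦⟧-× (obey? c κ) (toList κ ↭? m)) })

-- Counting the sinks of a star.

leafSinks : Vec Leaf n → ℕ
leafSinks []                = 0
leafSinks (just away ∷ c)   = leafSinks c
leafSinks (just toward ∷ c) = suc (leafSinks c)
leafSinks (nothing ∷ c)     = suc (leafSinks c)

-- A leaf above the centre stops the centre from being a sink, so from the first `just toward` on
-- only leaves are counted. The base value `1` is the centre, reached when no leaf lies above it.
sinks : Vec Leaf n → ℕ
sinks []                = 1
sinks (just away ∷ c)   = sinks c
sinks (just toward ∷ c) = suc (leafSinks c)
sinks (nothing ∷ c)     = suc (sinks c)

-- `sink` decides about the centre first, as vertex `zero`, while `sinks` does so in the course of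
-- scanning the leaves; a case split on the centre reconciles the two.
sink-star : (c : Vec Leaf n) → sink (star c) ≡ sinks c
sink-star c = centre (isSink? O zero) where
  O = starOrientation c

  leaf-sink : ∀ i → IsSink O (suc i) ⇔ lookup c i ≢ just away
  leaf-sink i = mk⇔
    (λ is-sink c[i]≡away → let e , eq = edge-surjective c i c[i]≡away in
      case trans (sym (cong proj₂ eq)) (is-sink e 1F (cong (suc ∘ proj₁) eq)) of λ ())
    (λ c[i]≢away e h at-i → ≢away⇒toward (λ eq → c[i]≢away (trans (sym (arrow-at-leaf c at-i)) (cong just eq))))
    where
    ≢away⇒toward : ∀ {a} → a ≢ away → a ≡ toward
    ≢away⇒toward {toward} _  = refl
    ≢away⇒toward {away}   a≢ = ⊥-elim (a≢ refl)

  centre-sink : IsSink O zero ⇔ (∀ i → lookup c i ≢ just toward)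
  centre-sink = mk⇔
    (λ is-sink i c[i]≡toward → let e , eq = edge-surjective c i c[i]≡toward in
      case trans (sym (cong (flip ∘ proj₂) eq)) (is-sink e 0F refl) of λ ())
    (λ { c≢toward e 0F _ → flip-toward (λ eq → c≢toward _ (trans (lookup-edge c e) (cong just eq)))
       ; _ _ 1F () })
    where
    flip-toward : ∀ {a} → a ≢ toward → flip a ≡ toward
    flip-toward {toward} a≢ = ⊥-elim (a≢ refl)
    flip-toward {away}   _  = refl

  -- Arbitrary `P?` and `f` let the induction pass to the tail of `c` while the vertices still
  -- belong to the original star.
  count-leaves : ∀ {m} (c : Vec Leaf m) {V : Set} {P : V → Set} (P? : Decidable P) (f : Fin m → V) →
    (∀ i → P (f i) ⇔ lookup c i ≢ just away) → length (filter P? (tabulate f)) ≡ leafSinks c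
  count-leaves []                P? f P⇔ = refl
  count-leaves (just away ∷ c)   P? f P⇔
    rewrite dec-false (P? (f zero)) (λ Pf → Equivalence.to (P⇔ zero) Pf refl) = count-leaves c P? (f ∘ suc) (P⇔ ∘ suc)
  count-leaves (just toward ∷ c) P? f P⇔
    rewrite dec-true (P? (f zero)) (Equivalence.from (P⇔ zero) λ ()) = cong suc (count-leaves c P? (f ∘ suc) (P⇔ ∘ suc))
  count-leaves (nothing ∷ c)     P? f P⇔
    rewrite dec-true (P? (f zero)) (Equivalence.from (P⇔ zero) λ ()) = cong suc (count-leaves c P? (f ∘ suc) (P⇔ ∘ suc))

  sinks-if-centre : ∀ {m} (c : Vec Leaf m) → (∀ i → lookup c i ≢ just toward) → sinks c ≡ suc (leafSinks c)
  sinks-if-centre []                _ = refl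
  sinks-if-centre (just away ∷ c)   h = sinks-if-centre c (h ∘ suc)
  sinks-if-centre (just toward ∷ c) h = ⊥-elim (h zero refl)
  sinks-if-centre (nothing ∷ c)     h = cong suc (sinks-if-centre c (h ∘ suc))

  sinks-if-not-centre : ∀ {m} (c : Vec Leaf m) → ¬ (∀ i → lookup c i ≢ just toward) → sinks c ≡ leafSinks c
  sinks-if-not-centre []                ¬h = ⊥-elim (¬h λ ())
  sinks-if-not-centre (just away ∷ c)   ¬h = sinks-if-not-centre c (λ h → ¬h λ { zero () ; (suc i) → h i })
  sinks-if-not-centre (just toward ∷ c) ¬h = refl
  sinks-if-not-centre (nothing ∷ c)     ¬h = cong suc (sinks-if-not-centre c (λ h → ¬h λ { zero () ; (suc i) → h i }))

  centre : Dec (IsSink O zero) → sink (star c) ≡ sinks c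
  centre (yes is-sink) rewrite dec-true (isSink? O zero) is-sink = trans
    (cong suc (count-leaves c (isSink? O) suc leaf-sink))
    (sym (sinks-if-centre c (Equivalence.to centre-sink is-sink)))
  centre (no ¬is-sink) rewrite dec-false (isSink? O zero) ¬is-sink = trans
    (count-leaves c (isSink? O) suc leaf-sink)
    (sym (sinks-if-not-centre c (¬is-sink ∘ Equivalence.from centre-sink)))

-- Coefficients of polynomials, and `φ` on explicit combinations.

coeff-+ : ∀ f g k → coeff (f +ᵖ g) k ≡ coeff f k ℚ.+ coeff g k
coeff-+ []      g       k       = sym (ℚ.+-identityˡ _)
coeff-+ (a ∷ f) []      k       = sym (ℚ.+-identityʳ _)
coeff-+ (a ∷ f) (b ∷ g) zero    = refl
coeff-+ (a ∷ f) (b ∷ g) (suc k) = coeff-+ f g k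

coeff-· : ∀ r f k → coeff (r ·ᵖ f) k ≡ r ℚ.* coeff f k
coeff-· r []      k       = sym (ℚ.*-zeroʳ r)
coeff-· r (a ∷ f) zero    = refl
coeff-· r (a ∷ f) (suc k) = coeff-· r f k

module _ (φ : RawLeftModule.Carrierᴹ 𝕐 → Poly) (linear : IsLinear φ) where
  private module φ = IsLinear linear

  -- Equality in `𝕐` compares only the series, so `φ` does not depend on the span witness; this
  -- allows replacing the given element by `0ᴹ` or by `(q *ₗ Y P) +ᴹ rest` and then using linearity.
  coeff-φ : ∀ {f} ts (f≈ts : f ≈ˢ combination ts) k →
    coeff (φ (f , ts , f≈ts)) k ≡ ∑[ (q , P) ∈ ts ] (q ℚ.* coeff (φ (Y P)) k)
  coeff-φ []             f≈ts k = trans (φ.⟦⟧-cong {y = RawLeftModule.0ᴹ 𝕐} f≈ts k) (φ.0ᴹ-homo k)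
  coeff-φ ((q , P) ∷ ts) f≈ts k = begin
    coeff (φ (_ , (q , P) ∷ ts , f≈ts)) k
      ≡⟨ φ.⟦⟧-cong {y = (q *ₗ Y P) +ᴹ rest} f≈ts k ⟩
    coeff (φ ((q *ₗ Y P) +ᴹ rest)) k
      ≡⟨ φ.+ᴹ-homo (q *ₗ Y P) rest k ⟩
    coeff (φ (q *ₗ Y P) +ᵖ φ rest) k
      ≡⟨ coeff-+ (φ (q *ₗ Y P)) (φ rest) k ⟩
    coeff (φ (q *ₗ Y P)) k ℚ.+ coeff (φ rest) k
      ≡⟨ cong₂ ℚ._+_ (trans (φ.*ₗ-homo q (Y P) k) (coeff-· q (φ (Y P)) k)) (coeff-φ ts (λ _ → refl) k) ⟩
    q ℚ.* coeff (φ (Y P)) k ℚ.+ ∑[ (q , P) ∈ ts ] (q ℚ.* coeff (φ (Y P)) k) ∎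
    where
    open ≡-Reasoning
    open RawLeftModule 𝕐 using (_+ᴹ_; _*ₗ_; Carrierᴹ)
    rest : Carrierᴹ
    rest = combination ts , ts , λ _ → refl

-- Linear functionals on polynomials.

-- The value at f of the linear functional that sends tʲ to v j.
⟨_∣_⟩ : Poly → (ℕ → ℚ) → ℚ
⟨ []    ∣ v ⟩ = 0ℚ
⟨ a ∷ f ∣ v ⟩ = a ℚ.* v 0 ℚ.+ ⟨ f ∣ v ∘ suc ⟩

⟨⟩-+ : ∀ f g v → ⟨ f +ᵖ g ∣ v ⟩ ≡ ⟨ f ∣ v ⟩ ℚ.+ ⟨ g ∣ v ⟩
⟨⟩-+ []      g       v = sym (ℚ.+-identityˡ _)
⟨⟩-+ (a ∷ f) []      v = sym (ℚ.+-identityʳ _)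
⟨⟩-+ (a ∷ f) (b ∷ g) v = trans (cong ((a ℚ.+ b) ℚ.* v 0 ℚ.+_) (⟨⟩-+ f g (v ∘ suc)))
  (solve 5 (λ a b v x y → (a :+ b) :* v :+ (x :+ y) := (a :* v :+ x) :+ (b :* v :+ y)) refl
    a b (v 0) ⟨ f ∣ v ∘ suc ⟩ ⟨ g ∣ v ∘ suc ⟩)

⟨⟩-· : ∀ r f v → ⟨ r ·ᵖ f ∣ v ⟩ ≡ r ℚ.* ⟨ f ∣ v ⟩
⟨⟩-· r []      v = sym (ℚ.*-zeroʳ r)
⟨⟩-· r (a ∷ f) v = trans (cong (r ℚ.* a ℚ.* v 0 ℚ.+_) (⟨⟩-· r f (v ∘ suc)))
  (solve 4 (λ r a v x → r :* a :* v :+ r :* x := r :* (a :* v :+ x)) refl r a (v 0) ⟨ f ∣ v ∘ suc ⟩)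

⟨⟩-neg : ∀ f v → ⟨ - f ∣ v ⟩ ≡ ℚ.- ⟨ f ∣ v ⟩
⟨⟩-neg []      v = refl
⟨⟩-neg (a ∷ f) v = trans (cong ((ℚ.- a) ℚ.* v 0 ℚ.+_) (⟨⟩-neg f (v ∘ suc)))
  (solve 3 (λ a v x → (:- a) :* v :+ (:- x) := :- (a :* v :+ x)) refl a (v 0) ⟨ f ∣ v ∘ suc ⟩)

⟨⟩-∷* : ∀ a f g v → ⟨ (a ∷ f) *ᵖ g ∣ v ⟩ ≡ a ℚ.* ⟨ g ∣ v ⟩ ℚ.+ ⟨ f *ᵖ g ∣ v ∘ suc ⟩
⟨⟩-∷* a f g v = trans (⟨⟩-+ (a ·ᵖ g) (0ℚ ∷ (f *ᵖ g)) v)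
  (cong₂ ℚ._+_ (⟨⟩-· a g v)
    (solve 2 (λ v x → con 0ℚ :* v :+ x := x) refl (v 0) ⟨ f *ᵖ g ∣ v ∘ suc ⟩))

-- Multiplication by `t` shifts `v` to `v ∘ suc`, so multiplication by `t - 1#` acts as the
-- difference operator on `v`.
⟨⟩-[t-1]* : ∀ g v → ⟨ (t - 1#) *ᵖ g ∣ v ⟩ ≡ ⟨ g ∣ v ∘ suc ⟩ ℚ.- ⟨ g ∣ v ⟩
⟨⟩-[t-1]* g v = trans (⟨⟩-∷* (ℚ.- 1ℚ) (1ℚ ∷ []) g v)
  (trans (cong ((ℚ.- 1ℚ) ℚ.* ⟨ g ∣ v ⟩ ℚ.+_) (⟨⟩-∷* 1ℚ [] g (v ∘ suc)))
    (solve 2 (λ x y → (:- con 1ℚ) :* x :+ (con 1ℚ :* y :+ con 0ℚ) := y :+ :- x) refl ⟨ g ∣ v ⟩ ⟨ g ∣ v ∘ suc ⟩))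

⟨⟩-[-1]* : ∀ g v → ⟨ (- 1#) *ᵖ g ∣ v ⟩ ≡ ℚ.- ⟨ g ∣ v ⟩
⟨⟩-[-1]* g v = trans (⟨⟩-∷* (ℚ.- 1ℚ) [] g v)
  (solve 1 (λ x → (:- con 1ℚ) :* x :+ con 0ℚ := :- x) refl ⟨ g ∣ v ⟩)

coeff-t* : ∀ f k → coeff (t *ᵖ f) (suc k) ≡ coeff f k
coeff-t* f k = trans (coeff-+ (0ℚ ·ᵖ f) (0ℚ ∷ ((1ℚ ·ᵖ f) +ᵖ (0ℚ ∷ []))) (suc k))
  (trans (cong₂ ℚ._+_ (coeff-· 0ℚ f (suc k)) (trans (coeff-+ (1ℚ ·ᵖ f) (0ℚ ∷ []) k) (cong₂ ℚ._+_ (coeff-· 1ℚ f k) (coeff-0 k))))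
    (solve 2 (λ x y → con 0ℚ :* x :+ (con 1ℚ :* y :+ con 0ℚ) := y) refl (coeff f (suc k)) (coeff f k)))
  where
  coeff-0 : ∀ k → coeff (0ℚ ∷ []) k ≡ 0ℚ
  coeff-0 zero    = refl
  coeff-0 (suc k) = refl

coeff-t*-zero : ∀ f → coeff (t *ᵖ f) 0 ≡ 0ℚ
coeff-t*-zero f = trans (coeff-+ (0ℚ ·ᵖ f) (0ℚ ∷ ((1ℚ ·ᵖ f) +ᵖ (0ℚ ∷ []))) 0)
  (trans (cong (ℚ._+ 0ℚ) (coeff-· 0ℚ f 0)) (solve 1 (λ x → con 0ℚ :* x :+ con 0ℚ := con 0ℚ) refl (coeff f 0)))

⟨⟩-cong : ∀ f {v w} → (∀ j → v j ≡ w j) → ⟨ f ∣ v ⟩ ≡ ⟨ f ∣ w ⟩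
⟨⟩-cong []      v≡w = refl
⟨⟩-cong (a ∷ f) v≡w = cong₂ ℚ._+_ (cong (a ℚ.*_) (v≡w 0)) (⟨⟩-cong f (v≡w ∘ suc))

⟨⟩-zero : ∀ f → ⟨ f ∣ (λ _ → 0ℚ) ⟩ ≡ 0ℚ
⟨⟩-zero []      = refl
⟨⟩-zero (a ∷ f) = cong₂ ℚ._+_ (ℚ.*-zeroʳ a) (⟨⟩-zero f)

-- Extracting coefficient `k` is the functional that takes `t ^ j` to its own coefficient `k`. The
-- induction works because one more factor `t` lowers the index by one, and gives `0ℚ` at index `0`.
coeff≡⟨⟩ : ∀ f k → coeff f k ≡ ⟨ f ∣ (λ j → coeff (t ^ j) k) ⟩
coeff≡⟨⟩ []      k       = refl
coeff≡⟨⟩ (a ∷ f) zero    = sym (trans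
  (cong (a ℚ.* 1ℚ ℚ.+_) (trans (⟨⟩-cong f (λ j → coeff-t*-zero (t ^ j))) (⟨⟩-zero f)))
  (solve 1 (λ a → a :* con 1ℚ :+ con 0ℚ := a) refl a))
coeff≡⟨⟩ (a ∷ f) (suc k) = trans (coeff≡⟨⟩ f k) (sym (trans
  (cong (a ℚ.* 0ℚ ℚ.+_) (⟨⟩-cong f (λ j → coeff-t* (t ^ j) k)))
  (solve 2 (λ a x → a :* con 0ℚ :+ x := x) refl a ⟨ f ∣ (λ j → coeff (t ^ j) k) ⟩)))

-- Evaluation of the signed sum over stars by sink number.

∑-weight : ∀ (f : Vec Leaf (suc n) → ℚ) →
  ∑[ c ∈ choices (suc n) ] (weight c ℚ.* f c) ≡
  ∑[ l ∈ leaves ] (leafWeight l ℚ.* ∑[ c ∈ choices n ] (weight c ℚ.* f (l ∷ c)))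
∑-weight {n} f = trans (∑-cartesianProductWith _∷_ leaves (choices n))
  (∑-cong leaves (λ l → trans
    (∑-cong (choices n) (λ c → ℚ.*-assoc (leafWeight l) (weight c) (f (l ∷ c))))
    (∑-*ˡ (choices n) (leafWeight l) _)))

-- An isolated leaf and a leaf above the centre are both sinks with opposite weights and cancel; a
-- leaf below the centre leaves the factor `−1`.
∑-leafSinks : ∀ n v → ∑[ c ∈ choices n ] (weight c ℚ.* v (leafSinks c)) ≡ ⟨ (- 1#) ^ n ∣ v ⟩
∑-leafSinks zero    v = refl
∑-leafSinks (suc n) v = begin
  ∑[ c ∈ choices (suc n) ] (weight c ℚ.* v (leafSinks c))
    ≡⟨ ∑-weight {n} (v ∘ leafSinks) ⟩
  1ℚ ℚ.* S (v ∘ suc) ℚ.+ ((ℚ.- 1ℚ) ℚ.* S (v ∘ suc) ℚ.+ ((ℚ.- 1ℚ) ℚ.* S v ℚ.+ 0ℚ))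
    ≡⟨ solve 2 (λ x y → con 1ℚ :* x :+ ((:- con 1ℚ) :* x :+ ((:- con 1ℚ) :* y :+ con 0ℚ)) := :- y) refl (S (v ∘ suc)) (S v) ⟩
  ℚ.- S v
    ≡⟨ cong ℚ.-_ (∑-leafSinks n v) ⟩
  ℚ.- ⟨ (- 1#) ^ n ∣ v ⟩
    ≡⟨ ⟨⟩-[-1]* ((- 1#) ^ n) v ⟨
  ⟨ (- 1#) ^ suc n ∣ v ⟩ ∎
  where
  open ≡-Reasoning
  S : (ℕ → ℚ) → ℚ
  S v = ∑[ c ∈ choices n ] (weight c ℚ.* v (leafSinks c))

-- Let `Sₙ` be the signed sum with `tʲ` in place of `v j`. Splitting off the first leaf gives
-- `Sₙ₊₁ = t Sₙ − t (−1)ⁿ − Sₙ`, the middle term coming from `∑-leafSinks` because the centre is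
-- then no sink. Arbitrary `v` is needed since a factor `t` becomes a shift to `v ∘ suc`.
∑-sinks : ∀ n v → ∑[ c ∈ choices n ] (weight c ℚ.* v (sinks c)) ≡ ⟨ (t - 1#) ^ suc n ∣ v ⟩ ℚ.- ⟨ (- 1#) ^ suc n ∣ v ⟩
-- The lone centre is a sink, and `t = (t − 1) − (−1)`.
∑-sinks zero    v = solve 2 (λ x y → con 1ℚ :* x :+ con 0ℚ := con (ℚ.- 1ℚ) :* y :+ (con 1ℚ :* x :+ con 0ℚ) :+ :- (con (ℚ.- 1ℚ) :* y :+ con 0ℚ)) refl (v 1) (v 0)
∑-sinks (suc n) v = begin
  ∑[ c ∈ choices (suc n) ] (weight c ℚ.* v (sinks c))
    ≡⟨ ∑-weight {n} (v ∘ sinks) ⟩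
  1ℚ ℚ.* S (v ∘ suc) ℚ.+ ((ℚ.- 1ℚ) ℚ.* ∑[ c ∈ choices n ] (weight c ℚ.* v (suc (leafSinks c))) ℚ.+ ((ℚ.- 1ℚ) ℚ.* S v ℚ.+ 0ℚ))
    ≡⟨ cong₂ (λ x y → 1ℚ ℚ.* x ℚ.+ y) (∑-sinks n (v ∘ suc))
         (cong₂ (λ x y → (ℚ.- 1ℚ) ℚ.* x ℚ.+ ((ℚ.- 1ℚ) ℚ.* y ℚ.+ 0ℚ)) (∑-leafSinks n (v ∘ suc)) (∑-sinks n v)) ⟩
  1ℚ ℚ.* (G (v ∘ suc) ℚ.- F (v ∘ suc)) ℚ.+ ((ℚ.- 1ℚ) ℚ.* ⟨ (- 1#) ^ n ∣ v ∘ suc ⟩ ℚ.+ ((ℚ.- 1ℚ) ℚ.* (G v ℚ.- F v) ℚ.+ 0ℚ))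
    -- Expanding `F (v ∘ suc)` produces the term that cancels the contribution of a first leaf above
    -- the centre.
    ≡⟨ cong (λ x → 1ℚ ℚ.* (G (v ∘ suc) ℚ.- x) ℚ.+ ((ℚ.- 1ℚ) ℚ.* ⟨ (- 1#) ^ n ∣ v ∘ suc ⟩ ℚ.+ ((ℚ.- 1ℚ) ℚ.* (G v ℚ.- F v) ℚ.+ 0ℚ)))
         (⟨⟩-[-1]* ((- 1#) ^ n) (v ∘ suc)) ⟩
  1ℚ ℚ.* (G (v ∘ suc) ℚ.- (ℚ.- ⟨ (- 1#) ^ n ∣ v ∘ suc ⟩)) ℚ.+ ((ℚ.- 1ℚ) ℚ.* ⟨ (- 1#) ^ n ∣ v ∘ suc ⟩ ℚ.+ ((ℚ.- 1ℚ) ℚ.* (G v ℚ.- F v) ℚ.+ 0ℚ))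
    ≡⟨ solve 4 (λ x y z w → con 1ℚ :* (x :+ :- (:- y)) :+ ((:- con 1ℚ) :* y :+ ((:- con 1ℚ) :* (z :+ :- w) :+ con 0ℚ)) :=
                            (x :+ :- z) :+ :- (:- w)) refl (G (v ∘ suc)) ⟨ (- 1#) ^ n ∣ v ∘ suc ⟩ (G v) (F v) ⟩
  (G (v ∘ suc) ℚ.- G v) ℚ.- (ℚ.- F v)
    ≡⟨ cong₂ ℚ._-_ (⟨⟩-[t-1]* ((t - 1#) ^ suc n) v) (⟨⟩-[-1]* ((- 1#) ^ suc n) v) ⟨
  ⟨ (t - 1#) ^ suc (suc n) ∣ v ⟩ ℚ.- ⟨ (- 1#) ^ suc (suc n) ∣ v ⟩ ∎
  where
  open ≡-Reasoning
  S G F : (ℕ → ℚ) → ℚ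
  S v = ∑[ c ∈ choices n ] (weight c ℚ.* v (sinks c))
  G v = ⟨ (t - 1#) ^ suc n ∣ v ⟩
  F v = ⟨ (- 1#) ^ suc n ∣ v ⟩

-- The value of `φ` at the power sum.

theorem6p5 : (a : ℕ) .{{_ : NonZero a}} →
    Σ (InSpan (p a 0)) λ p∈𝕐 →
    (φ : RawLeftModule.Carrierᴹ 𝕐 → Poly) → IsLinear φ →
    (∀ P → φ (Y P) ≈ t ^ sink P) →
    φ (p a 0 , p∈𝕐) ≈ (t - 1#) ^ a - (- 1#) ^ a
theorem6p5 (suc n) = p∈𝕐 , λ φ linear φ-Y k →
  -- For this `v` the functional reads off coefficient `k`, and the hypothesis on `φ` says that the
  -- coefficient of `φ (Y P)` is `v (sink P)`.
  let v = λ j → coeff (t ^ j) k in begin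
  coeff (φ (p (suc n) 0 , p∈𝕐)) k
    ≡⟨ coeff-φ φ linear (terms n) (p≈combination n) k ⟩
  ∑[ (q , P) ∈ terms n ] (q ℚ.* coeff (φ (Y P)) k)
    ≡⟨ ∑-map (λ c → weight c , star c) (choices n) ⟩
  ∑[ c ∈ choices n ] (weight c ℚ.* coeff (φ (Y (star c))) k)
    ≡⟨ ∑-cong (choices n) (λ c → cong (weight c ℚ.*_) (trans (φ-Y (star c) k) (cong v (sink-star c)))) ⟩
  ∑[ c ∈ choices n ] (weight c ℚ.* v (sinks c))
    ≡⟨ ∑-sinks n v ⟩
  ⟨ (t - 1#) ^ suc n ∣ v ⟩ ℚ.- ⟨ (- 1#) ^ suc n ∣ v ⟩
    ≡⟨ cong (⟨ (t - 1#) ^ suc n ∣ v ⟩ ℚ.+_) (⟨⟩-neg ((- 1#) ^ suc n) v) ⟨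
  ⟨ (t - 1#) ^ suc n ∣ v ⟩ ℚ.+ ⟨ - (- 1#) ^ suc n ∣ v ⟩
    ≡⟨ ⟨⟩-+ ((t - 1#) ^ suc n) (- (- 1#) ^ suc n) v ⟨
  ⟨ (t - 1#) ^ suc n - (- 1#) ^ suc n ∣ v ⟩
    ≡⟨ coeff≡⟨⟩ ((t - 1#) ^ suc n - (- 1#) ^ suc n) k ⟨
  coeff ((t - 1#) ^ suc n - (- 1#) ^ suc n) k ∎
  where
  open ≡-Reasoning
  p∈𝕐 : InSpan (p (suc n) 0)
  p∈𝕐 = terms n , p≈combination n
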